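{- There exists an absolute constant $C>0$ such that the following holds. For every tree $T$ on $t$ vertices there is $s_0=s_0(t)$ such that for every integer $s\ge s_0$ and every positive integer $n$, $$\mathrm{ex}^*(n,T,s)\le s^{Ct}\,n.$$
   Context: For a graph $H$ and positive integers $n,s$, $\mathrm{ex}^*(n,H,s)$ denotes the maximum number of edges in an $n$-vertex graph which contains no copy of the complete bipartite graph $K_{s,s}$ as a (not necessarily induced) subgraph and contains no induced subgraph isomorphic to $H$. -}

module Defs where

open import Data.Nat using (ℕ; zero; suc; _+_; _*_; _^_; _≤_; _<_; _∸_; _<ᵇ_)
open import Data.Fin using (Fin; toℕ)
open import Data.Bool using (Bool; true; false; if_then_else_; _∧_)
open import Data.List using (List; map; allFin)
open import Data.Nat.ListAction using (sum)
open import Data.Product using (Σ; ∃; _×_; _,_)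
open import Relation.Binary.PropositionalEquality using (_≡_; _≢_)
open import Relation.Nullary using (¬_)
open import Function.Definitions using (Injective)

record Graph (n : ℕ) : Set where
  field
    adj   : Fin n → Fin n → Bool
    sym   : ∀ i j → adj i j ≡ adj j i
    irrefl : ∀ i → adj i i ≡ false
open Graph public

edges : ∀ {n} → Graph n → ℕ
edges {n} G =
  sum (map (λ i → sum (map (λ j → if adj G i j ∧ (toℕ i <ᵇ toℕ j) then 1 else 0)
                           (allFin n)))
           (allFin n))

data Reach {n} (G : Graph n) : Fin n → Fin n → Set where
  here : ∀ {i} → Reach G i i
  step : ∀ {i j k} → adj G i j ≡ true → Reach G j k → Reach G i k

Connected : ∀ {n} → Graph n → Set
Connected {n} G = ∀ (i j : Fin n) → Reach G i j

IsTree : ∀ {t} → Graph t → Set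
IsTree {t} T = (1 ≤ t) × Connected T × (edges T ≡ t ∸ 1)

ContainsKss : ∀ {n} → ℕ → Graph n → Set
ContainsKss {n} s G =
  Σ (Fin s → Fin n) λ f → Σ (Fin s → Fin n) λ g →
    Injective _≡_ _≡_ f × Injective _≡_ _≡_ g ×
    (∀ i j → f i ≢ g j) × (∀ i j → adj G (f i) (g j) ≡ true)

ContainsInduced : ∀ {n h} → Graph h → Graph n → Set
ContainsInduced {n} {h} H G =
  Σ (Fin h → Fin n) λ φ →
    Injective _≡_ _≡_ φ × (∀ i j → adj G (φ i) (φ j) ≡ adj H i j)

{-# OPTIONS --safe #-}
module Submission where

-- Write N[v] for the closed neighbourhood of v, put M = 4s, and call v rich of depth k + 1 inside F
-- if at least q of its neighbours w in F are rich of depth k inside F ∖ N[v].  A vertex u kills v if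
-- deleting N[u] from F makes v no longer rich for the parameter q / M.
--
-- K_{s,s}-freeness makes killers rare.  Fewer than s vertices are adjacent to more than a proportion
-- 1 - 1/2s of a given large set W of good children of v.  Any other killer u must kill a proportion
-- at least 1/M of W, so by induction and double counting there are fewer than M^k killers in all.
--
-- Hence some vertex is rich of depth t as soon as G has many edges: for w rich of depth k, all but
-- M^k of the edges vw make w a good child of v, and a vertex v that is not rich of depth k + 1 has
-- fewer than q good children, so each level costs at most (M^k + q) n in the sum of the degrees.
--
-- Finally T is embedded greedily, leaf by leaf.  The image of a new leaf is taken among the at least
-- M q good children of its parent's image, avoiding the fewer than M^k killers of every vertex
-- embedded so far; what remains in play is not adjacent to it, so the copy stays induced.

open import Defs
open import Data.Bool using (Bool; true; false; T; not; _∧_; _∨_; if_then_else_)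
open import Data.Bool.Properties using (T-≡; T-∧; T?)
open import Data.Empty using (⊥-elim)
open import Data.Fin using (Fin; zero; suc; toℕ; _≟_)
open import Data.Fin.Permutation using (Permutation; permutation; ↔⇒≡)
open import Data.Fin.Properties using (suc-injective; toℕ-injective)
open import Data.List.Base as List using (List; []; _∷_; length; lookup; allFin; tabulate)
open import Data.List.Membership.Propositional using (_∈_; _∉_)
open import Data.List.Membership.Propositional.Properties using (∈-lookup; ∈-allFin)
open import Data.List.Properties using (map-tabulate)
open import Data.List.Relation.Binary.Subset.Propositional using (_⊆_)
open import Data.List.Relation.Unary.Any using (here; there; index; any?)
open import Data.List.Relation.Unary.Any.Properties using (lookup-index)
open import Data.Nat hiding (_≟_)
import Data.Nat.ListAction as ListAction
open import Data.Nat.Properties hiding (_≟_; suc-injective)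
open import Data.Nat.Tactic.RingSolver using (solve-∀)
open import Data.Product using (Σ; ∃; _×_; _,_; proj₁; proj₂)
open import Data.Sum using (_⊎_; inj₁; inj₂)
open import Data.Unit using (tt)
open import Function.Base using (_∘_; id; case_of_)
open import Function.Bundles using (Equivalence)
open import Function.Definitions using (Injective)
open import Relation.Binary.PropositionalEquality as ≡ using (_≡_; _≢_; refl; cong; cong₂; subst)
open import Relation.Nullary using (¬_; Dec; yes; no; does; contradiction)
open import Relation.Nullary.Decidable using (dec-true)
open import Algebra.Properties.Semiring.Sum +-*-semiring
  using (sum; sum-syntax; sum-cong-≗; sum-permute; ∑-distrib-+; ∑-comm; *-distribˡ-sum)

-- Counting with Boolean predicates on finite sets.

⟦_⟧ : Bool → ℕ
⟦ b ⟧ = if b then 1 else 0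

# : ∀ {n} → (Fin n → Bool) → ℕ
# p = sum (λ i → ⟦ p i ⟧)

∧-intro : ∀ {a b} → T a → T b → T (a ∧ b)
∧-intro x y = Equivalence.from T-∧ (x , y)

∧-elim : ∀ {a b} → T (a ∧ b) → T a × T b
∧-elim = Equivalence.to T-∧

∨-introˡ : ∀ a {b} → T a → T (a ∨ b)
∨-introˡ true _ = tt

∨-introʳ : ∀ a {b} → T b → T (a ∨ b)
∨-introʳ true  _ = tt
∨-introʳ false h = h

∨-elim : ∀ a {b} → T (a ∨ b) → T a ⊎ T b
∨-elim true  h = inj₁ tt
∨-elim false h = inj₂ h

not-intro : ∀ {a} → ¬ T a → T (not a)
not-intro {false} _ = tt
not-intro {true}  h = h tt

¬T⇒false : ∀ {a} → ¬ T a → a ≡ false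
¬T⇒false {false} _ = refl
¬T⇒false {true}  h = ⊥-elim (h tt)

not-elim : ∀ {a} → T (not a) → ¬ T a
not-elim {false} _ ()

∑-mono : ∀ {n} {f g : Fin n → ℕ} → (∀ i → f i ≤ g i) → sum f ≤ sum g
∑-mono {zero}  h = z≤n
∑-mono {suc n} h = +-mono-≤ (h zero) (∑-mono (h ∘ suc))

∑-const : ∀ n c → sum {n} (λ _ → c) ≡ n * c
∑-const zero    c = refl
∑-const (suc n) c = cong (c +_) (∑-const n c)

∑-pos : ∀ {n} {f : Fin n → ℕ} → 0 < sum f → ∃ λ i → 0 < f i
∑-pos {suc n} {f} h with f zero in eq
... | suc m = zero , subst (0 <_) (≡.sym eq) z<s
... | zero  = let (i , hi) = ∑-pos h in suc i , hi

⟦⟧-pos : ∀ {b} → 0 < ⟦ b ⟧ → T b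
⟦⟧-pos {true} _ = tt

*-⟦⟧-≤ : ∀ {m c} b → (T b → m ≤ c) → m * ⟦ b ⟧ ≤ c
*-⟦⟧-≤ {m} true  h = ≤-trans (≤-reflexive (*-identityʳ m)) (h tt)
*-⟦⟧-≤ {m} false h = ≤-trans (≤-reflexive (*-zeroʳ m)) z≤n

#-∃ : ∀ {n} {p : Fin n → Bool} → 0 < # p → ∃ λ i → T (p i)
#-∃ h = let (i , hi) = ∑-pos h in i , ⟦⟧-pos hi

#-pos : ∀ {n} {p : Fin n → Bool} {i} → T (p i) → 0 < # p
#-pos {p = p} {zero}  h with true ← p zero = z<s
#-pos {p = p} {suc i} h = ≤-trans (#-pos {p = p ∘ suc} h) (m≤n+m _ ⟦ p zero ⟧)

#-mono : ∀ {n} (p q : Fin n → Bool) → (∀ i → T (p i) → T (q i)) → # p ≤ # q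
#-mono p q h = ∑-mono λ i → le (p i) (q i) (h i)
  where
  le : ∀ a b → (T a → T b) → ⟦ a ⟧ ≤ ⟦ b ⟧
  le false b     f = z≤n
  le true  true  f = ≤-refl
  le true  false f = ⊥-elim (f tt)

#-cover : ∀ {n} (p q r : Fin n → Bool) →
          (∀ i → T (p i) → T (q i) ⊎ T (r i)) → # p ≤ # q + # r
#-cover p q r h = ≤-trans (∑-mono λ i → le (p i) (q i) (r i) (h i))
                          (≤-reflexive (∑-distrib-+ (⟦_⟧ ∘ q) (⟦_⟧ ∘ r)))
  where
  le : ∀ a b c → (T a → T b ⊎ T c) → ⟦ a ⟧ ≤ ⟦ b ⟧ + ⟦ c ⟧
  le false b     c     f = z≤n
  le true  true  c     f = s≤s z≤n
  le true  false true  f = ≤-refl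
  le true  false false f with f tt
  ... | inj₁ ()
  ... | inj₂ ()

#-none : ∀ {n} (p : Fin n → Bool) → (∀ i → ¬ T (p i)) → # p ≡ 0
#-none p h with # p in eq
... | zero  = refl
... | suc m = let (i , hi) = #-∃ (subst (0 <_) (≡.sym eq) z<s) in ⊥-elim (h i hi)

#-single : ∀ {n} (u : Fin n) → # (λ x → does (u ≟ x)) ≡ 1
#-single {suc n} zero = cong suc (#-none {n} (λ x → does (zero ≟ suc x)) λ _ ())
#-single {suc n} (suc u) = #-single u

#-unique : ∀ {n} {p : Fin n → Bool} → # p ≤ 1 → ∀ {i j} → T (p i) → T (p j) → i ≡ j
#-unique {p = p} h {zero}  {zero}  x y = refl
#-unique {p = p} h {zero}  {suc j} x y with true ← p zero =
  contradiction (s≤s⁻¹ h) (<⇒≱ (#-pos {p = p ∘ suc} y))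
#-unique {p = p} h {suc i} {zero}  x y with true ← p zero =
  contradiction (s≤s⁻¹ h) (<⇒≱ (#-pos {p = p ∘ suc} x))
#-unique {p = p} h {suc i} {suc j} x y =
  cong suc (#-unique (≤-trans (m≤n+m _ ⟦ p zero ⟧) h) x y)

#-select : ∀ {n} s (p : Fin n → Bool) → s ≤ # p →
           Σ (Fin s → Fin n) λ f → Injective _≡_ _≡_ f × (∀ i → T (p (f i)))
#-select zero p h = (λ ()) , (λ {}) , λ ()
#-select {suc n} (suc s) p h with p zero in eq
... | false = let (f , inj , ok) = #-select (suc s) (p ∘ suc) h
              in suc ∘ f , inj ∘ suc-injective , ok
... | true  = g , g-inj , g-ok
  where
  rec = #-select s (p ∘ suc) (s≤s⁻¹ h)
  g : Fin (suc s) → Fin (suc n)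
  g zero    = zero
  g (suc i) = suc (proj₁ rec i)
  g-inj : Injective _≡_ _≡_ g
  g-inj {zero}  {zero}  e = refl
  g-inj {suc i} {suc j} e = cong suc (proj₁ (proj₂ rec) (suc-injective e))
  g-ok : ∀ i → T (p (g i))
  g-ok zero    = Equivalence.from T-≡ eq
  g-ok (suc i) = proj₂ (proj₂ rec) i

-- Union bound: imposing the tests one after another, each one discards from the current set only
-- elements of `p` that fail it. It is used both for common neighbours and for the choice of a new
-- leaf.
#-common : ∀ {n s} (p : Fin n → Bool) (q : Fin s → Fin n → Bool) →
           Σ (Fin n → Bool) λ r → (∀ x → T (r x) → T (p x) × (∀ i → T (q i x))) ×
             # p ≤ # r + ∑[ i < s ] # (λ x → p x ∧ not (q i x))
#-common {s = zero}  p q = p , (λ x h → h , λ ()) , m≤m+n _ _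
#-common {n} {suc s} p q =
  let (r , r-ok , r-large) = #-common p (q ∘ suc)
      r₀ = λ x → r x ∧ q zero x
      lost = λ i → # (λ x → p x ∧ not (q i x))
  in r₀
   , (λ x h → let (rx , qx) = ∧-elim {r x} h ; (px , qs) = r-ok x rx in
        px , λ { zero → qx ; (suc i) → qs i })
   , (begin
        # p                                     ≤⟨ r-large ⟩
        # r + sum (lost ∘ suc)                  ≤⟨ +-monoˡ-≤ _ (#-cover r r₀ _ λ x rx →
                                                     split x rx (proj₁ (r-ok x rx))) ⟩
        (# r₀ + lost zero) + sum (lost ∘ suc)   ≡⟨ +-assoc (# r₀) _ _ ⟩
        # r₀ + sum lost                         ∎)
  where
  open ≤-Reasoning
  split : ∀ {a b} x → T a → T b → T (a ∧ q zero x) ⊎ T (b ∧ not (q zero x))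
  split x a b with T? (q zero x)
  ... | yes y = inj₁ (∧-intro a y)
  ... | no ¬y = inj₂ (∧-intro b (not-intro ¬y))

-- Degrees and edges.

∑-allFin : ∀ {n} (f : Fin n → ℕ) → ListAction.sum (List.map f (allFin n)) ≡ sum f
∑-allFin f = ≡.trans (cong ListAction.sum (map-tabulate id f)) (go f)
  where
  go : ∀ {n} (f : Fin n → ℕ) → ListAction.sum (tabulate f) ≡ sum f
  go {zero}  f = refl
  go {suc n} f = cong (f zero +_) (go (f ∘ suc))

-- Each degree splits into upward and downward neighbours. Exchanging the summations turns the
-- downward total into the upward one, and the upward total is `edges G`.
handshake : ∀ {n} (G : Graph n) → ∑[ i < n ] # (adj G i) ≡ 2 * edges G
handshake {n} G = begin
  ∑[ i < n ] # (adj G i)                                ≡⟨ sum-cong-≗ degree-split ⟩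
  ∑[ i < n ] (sum (up i) + ∑[ j < n ] up j i)           ≡⟨ ∑-distrib-+ (sum ∘ up) (λ i → ∑[ j < n ] up j i) ⟩
  e + ∑[ i < n ] ∑[ j < n ] up j i                      ≡⟨ cong (e +_) (∑-comm up) ⟨
  e + e                                                 ≡⟨ cong (e +_) (+-identityʳ e) ⟨
  2 * e                                                 ≡⟨ cong (2 *_) e≡edges ⟨
  2 * edges G                                           ∎
  where
  open ≡.≡-Reasoning
  up : Fin n → Fin n → ℕ
  up i j = ⟦ adj G i j ∧ (toℕ i <ᵇ toℕ j) ⟧
  e : ℕ
  e = ∑[ i < n ] ∑[ j < n ] up i j
  e≡edges : edges G ≡ e
  e≡edges = ≡.trans (∑-allFin (λ i → ListAction.sum (List.map (up i) (allFin n)))) (sum-cong-≗ (∑-allFin ∘ up))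
  one-way : ∀ a b → a ≢ b → 1 ≡ ⟦ a <ᵇ b ⟧ + ⟦ b <ᵇ a ⟧
  one-way zero    zero    h = ⊥-elim (h refl)
  one-way zero    (suc b) h = refl
  one-way (suc a) zero    h = refl
  one-way (suc a) (suc b) h = one-way a b (h ∘ cong suc)
  cases : ∀ i j → ⟦ adj G i j ⟧ ≡ up i j + up j i
  cases i j rewrite sym G j i with adj G i j in eq
  ... | false = refl
  ... | true  = one-way (toℕ i) (toℕ j) λ e →
    case ≡.trans (≡.sym eq) (≡.trans (cong (adj G i) (≡.sym (toℕ-injective e))) (irrefl G i)) of λ ()
  degree-split : ∀ i → # (adj G i) ≡ sum (up i) + ∑[ j < n ] up j i
  degree-split i = ≡.trans (sum-cong-≗ (cases i)) (∑-distrib-+ (up i) (λ j → up j i))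

-- The newest vertex is the head, and it has exactly one neighbour among the older ones, at position
-- `p`. The Boolean equation has the shape in which adjacencies of an induced copy are compared.
data Order {t} (H : Graph t) : List (Fin t) → Set where
  root : ∀ v → Order H (v ∷ [])
  leaf : ∀ {xs} w (p : Fin (length xs)) → Order H xs →
         (∀ a → adj H w (lookup xs a) ≡ does (a ≟ p)) → Order H (w ∷ xs)

-- Rich vertices and their children.

module Rich {n : ℕ} (G : Graph n) where

  infixl 5 _∖_

  _∖_ : (Fin n → Bool) → Fin n → (Fin n → Bool)
  (F ∖ u) x = F x ∧ not (adj G u x ∨ does (u ≟ x))

  ∖-intro : ∀ {F u x} → T (F x) → ¬ T (adj G u x) → u ≢ x → T ((F ∖ u) x)
  ∖-intro {F} {u} {x} Fx ¬ux u≢x with adj G u x | u ≟ x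
  ... | true  | _       = ⊥-elim (¬ux tt)
  ... | false | yes u≡x = ⊥-elim (u≢x u≡x)
  ... | false | no _    = ∧-intro Fx tt

  ∖-elim : ∀ {F u x} → T ((F ∖ u) x) → T (F x) × ¬ T (adj G u x) × u ≢ x
  ∖-elim {F} {u} {x} h with ∧-elim {F x} h
  ... | Fx , k with adj G u x | u ≟ x
  ... | false | no u≢x = Fx , id , u≢x

  mutual
    -- Membership in `F` is asked of the children only, not of `v`. This matters because a child of
    -- `v` lies in N[v], so it has been deleted from the very set in which its own richness is
    -- tested.
    rich : ℕ → ℕ → (Fin n → Bool) → Fin n → Bool
    rich zero    q F v = true
    rich (suc k) q F v = q ≤ᵇ # (children k q F v)

    children : ℕ → ℕ → (Fin n → Bool) → Fin n → Fin n → Bool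
    children k q F v w = adj G v w ∧ (F w ∧ rich k q (F ∖ v) w)

  children-intro : ∀ {k q F v w} → T (adj G v w) → T (F w) → T (rich k q (F ∖ v) w) →
                   T (children k q F v w)
  children-intro a b c = ∧-intro a (∧-intro b c)

  children-elim : ∀ {k q F v w} → T (children k q F v w) →
                  T (adj G v w) × T (F w) × T (rich k q (F ∖ v) w)
  children-elim {F = F} {v} {w} h = let (a , bc) = ∧-elim {adj G v w} h in a , ∧-elim {F w} bc

  rich-mono : ∀ k {q q′ F F′ v} → q′ ≤ q → (∀ {x} → T (F x) → T (F′ x)) →
              T (rich k q F v) → T (rich k q′ F′ v)
  rich-mono zero    q′≤q F⊆ h = tt
  rich-mono (suc k) {q} {q′} {F} {F′} {v} q′≤q F⊆ h =
    ≤⇒≤ᵇ (≤-trans q′≤q (≤-trans (≤ᵇ⇒≤ q _ h) (#-mono (children k q F v) (children k q′ F′ v) λ w c →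
      let (vw , Fw , r) = children-elim {k} {q} {F} c in
      children-intro {k} {q′} {F′} vw (F⊆ Fw) (rich-mono k q′≤q ∖⊆ r))))
    where
    ∖⊆ : ∀ {x} → T ((F ∖ v) x) → T ((F′ ∖ v) x)
    ∖⊆ h = let (Fx , ¬a , ≢) = ∖-elim {F} h in ∖-intro {F′} (F⊆ Fx) ¬a ≢

  rich-lower : ∀ k {q F v} → T (rich (suc k) q F v) → T (rich k q F v)
  rich-lower zero    h = tt
  rich-lower (suc k) {q} {F} {v} h = ≤⇒≤ᵇ (≤-trans (≤ᵇ⇒≤ q _ h) (#-mono (children (suc k) q F v) (children k q F v) λ w c →
    let (vw , Fw , r) = children-elim {suc k} {q} {F} c in
    children-intro {k} {q} {F} vw Fw (rich-lower k r)))

  ∖-swap : ∀ {F u v x} → T ((F ∖ u ∖ v) x) → T ((F ∖ v ∖ u) x)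
  ∖-swap {F} {u} {v} h =
    let (h₁ , ¬vx , v≢x) = ∖-elim {F ∖ u} h
        (Fx , ¬ux , u≢x) = ∖-elim {F} h₁
    in ∖-intro {F ∖ v} (∖-intro {F} Fx ¬vx v≢x) ¬ux u≢x

  full : Fin n → Bool
  full _ = true

  -- Rarity of killers in a graph without `K_{s,s}`.

  module Biclique-free {s : ℕ} (s>0 : 0 < s) (Kss-free : ¬ ContainsKss s G) where

    M : ℕ
    M = 4 * s

    M>0 : 0 < M
    M>0 = ≤-trans s>0 (m≤n*m s 4)

    -- The vertex `u` misses less than a proportion 1/2s of `W`, with the denominator cleared.
    dominates : (Fin n → Bool) → Fin n → Bool
    dominates W u = # (λ w → W w ∧ not (adj G u w)) * (2 * s) <ᵇ # W

    -- Any `s` dominators together miss at most half of `W`, so at least `s` vertices of `W` are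
    -- adjacent to all of them, which is a `K_{s,s}`.
    few-dominators : ∀ W → 2 * s ≤ # W → # (dominates W) < s
    few-dominators W large = ≰⇒> λ many →
      let (f , f-inj , f-dom) = #-select s (dominates W) many
          (C , C-ok , C-large) = #-common W (λ i → adj G (f i))
          (g , g-inj , g-C) = #-select s C (s≤#C f C f-dom C-large)
          fg = λ i j → Equivalence.to T-≡ (proj₂ (C-ok (g j) (g-C j)) i)
      in Kss-free (f , g , f-inj , g-inj
           -- The two sides are disjoint, since a shared vertex would be adjacent to itself.
           , (λ i j e → case ≡.trans (≡.sym (fg i j)) (≡.trans (cong (adj G (f i)) (≡.sym e)) (irrefl G (f i)))
                        of λ ())
           , fg)
      where
      missed : Fin n → ℕ
      missed u = # (λ w → W w ∧ not (adj G u w))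
      open ≤-Reasoning
      s≤#C : ∀ (f : Fin s → Fin n) C → (∀ i → T (dominates W (f i))) →
             # W ≤ # C + ∑[ i < s ] missed (f i) → s ≤ # C
      s≤#C f C f-dom C-large = *-cancelˡ-≤ 2 (≤-trans large
       (*-cancelˡ-≤ s {{>-nonZero s>0}} (+-cancelʳ-≤ (s * # W) _ _ (begin
        s * # W + s * # W                                    ≡⟨ dbl s (# W) ⟩
        (2 * s) * # W                                        ≤⟨ *-monoʳ-≤ (2 * s) C-large ⟩
        (2 * s) * (# C + ∑[ i < s ] missed (f i))            ≡⟨ *-distribˡ-+ (2 * s) (# C) _ ⟩
        (2 * s) * # C + (2 * s) * ∑[ i < s ] missed (f i)    ≡⟨ cong₂ _+_ (swp s (# C)) (*-distribˡ-sum (2 * s) (missed ∘ f)) ⟩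
        s * (2 * # C) + ∑[ i < s ] ((2 * s) * missed (f i))  ≤⟨ +-monoʳ-≤ (s * (2 * # C)) (∑-mono each) ⟩
        s * (2 * # C) + ∑[ i < s ] # W                       ≡⟨ cong (s * (2 * # C) +_) (∑-const s (# W)) ⟩
        s * (2 * # C) + s * # W                              ∎))))
        where
        dbl : ∀ a b → a * b + a * b ≡ (2 * a) * b
        dbl = solve-∀
        swp : ∀ a b → (2 * a) * b ≡ a * (2 * b)
        swp = solve-∀
        each : ∀ i → (2 * s) * missed (f i) ≤ # W
        each i = ≤-trans (≤-reflexive (*-comm (2 * s) (missed (f i)))) (<⇒≤ (<ᵇ⇒< _ _ (f-dom i)))

    kills : ℕ → ℕ → (Fin n → Bool) → Fin n → Fin n → Bool
    kills k q F v u = not (rich k q (F ∖ u) v)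

    few-killers : ∀ k q F v → 0 < q → T (rich k (M * q) F v) → # (kills k q F v) < M ^ k
    few-killers zero    q F v q>0 h = subst (_< 1) (≡.sym (#-none (kills 0 q F v) λ _ ())) ≤-refl
    few-killers (suc k) q F v q>0 h = begin-strict
      # (kills (suc k) q F v)      ≤⟨ #-cover _ (dominates W) spoils kill-cover ⟩
      # (dominates W) + # spoils   <⟨ +-mono-<-≤ (few-dominators W 2s≤#W) few-spoilers ⟩
      s + M * m                    ≤⟨ +-monoˡ-≤ (M * m) (m≤n*m s 4) ⟩
      M + M * m                    ≡⟨ *-suc M m ⟨
      M * suc m                    ≡⟨ cong (M *_) sm ⟩
      M * M ^ k                    ∎
      where
      open ≤-Reasoning
      W : Fin n → Bool
      W = children k (M * q) F v
      Mq≤#W : M * q ≤ # W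
      Mq≤#W = ≤ᵇ⇒≤ (M * q) (# W) h
      2s≤#W : 2 * s ≤ # W
      2s≤#W = ≤-trans (*-monoˡ-≤ s {2} {4} (s≤s (s≤s z≤n))) (≤-trans (m≤m*n M q {{>-nonZero q>0}}) Mq≤#W)
      instance
        #W≢0 : NonZero (# W)
        #W≢0 = >-nonZero (≤-trans (*-mono-≤ M>0 q>0) Mq≤#W)
      -- By induction a child has at most `M ^ k - 1` killers. The unit saved here, multiplied by
      -- `M`, pays for the dominators, of which there are fewer than `s`.
      m : ℕ
      m = pred (M ^ k)
      sm : suc m ≡ M ^ k
      sm = suc-pred (M ^ k) {{m^n≢0 M k {{>-nonZero M>0}}}}
      killed : Fin n → Fin n → Bool
      killed u w = W w ∧ kills k q (F ∖ v) w u
      spoils : Fin n → Bool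
      spoils u = # W ≤ᵇ M * # (killed u)

      -- Double counting of pairs `(u, w)` where `u` kills the child `w`: a spoiler occurs in at
      -- least `# W / M` pairs, a child in at most `m`.
      few-spoilers : # spoils ≤ M * m
      few-spoilers = *-cancelʳ-≤ (# spoils) (M * m) (# W) (begin
        # spoils * # W                                        ≡⟨ *-comm (# spoils) (# W) ⟩
        # W * # spoils                                        ≡⟨ *-distribˡ-sum (# W) (⟦_⟧ ∘ spoils) ⟩
        ∑[ u < n ] (# W * ⟦ spoils u ⟧)                       ≤⟨ ∑-mono each-spoiler ⟩
        ∑[ u < n ] (M * # (killed u))                         ≡⟨ *-distribˡ-sum M (λ u → # (killed u)) ⟨
        M * ∑[ u < n ] # (killed u)                           ≡⟨ cong (M *_) (∑-comm (λ u w → ⟦ killed u w ⟧)) ⟩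
        M * ∑[ w < n ] # (λ u → killed u w)                   ≤⟨ *-monoʳ-≤ M (∑-mono each-child) ⟩
        M * ∑[ w < n ] (m * ⟦ W w ⟧)                          ≡⟨ cong (M *_) (*-distribˡ-sum m (⟦_⟧ ∘ W)) ⟨
        M * (m * # W)                                         ≡⟨ *-assoc M m (# W) ⟨
        M * m * # W                                           ∎)
        where
        each-spoiler : ∀ u → # W * ⟦ spoils u ⟧ ≤ M * # (killed u)
        each-spoiler u = *-⟦⟧-≤ (spoils u) (≤ᵇ⇒≤ (# W) _)
        each-child : ∀ w → # (λ u → killed u w) ≤ m * ⟦ W w ⟧
        each-child w with T? (W w)
        ... | yes y = begin
          # (λ u → killed u w)      ≤⟨ #-mono (λ u → killed u w) _ (λ u x → proj₂ (∧-elim {W w} x)) ⟩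
          # (kills k q (F ∖ v) w)   ≤⟨ s≤s⁻¹ (subst (# (kills k q (F ∖ v) w) <_) (≡.sym sm)
                                               (few-killers k q (F ∖ v) w q>0 w-rich)) ⟩
          m                         ≡⟨ *-identityʳ m ⟨
          m * 1                     ≡⟨ cong (λ b → m * ⟦ b ⟧) (Equivalence.to T-≡ y) ⟨
          m * ⟦ W w ⟧               ∎
          where
          w-rich : T (rich k (M * q) (F ∖ v) w)
          w-rich = proj₂ (proj₂ (children-elim {k} {M * q} {F} y))
        ... | no ¬y = ≤-trans (≤-reflexive (#-none (λ u → killed u w) λ u x → ¬y (proj₁ (∧-elim {W w} x)))) z≤n

      -- The choice `M = 4 * s` enters here. A non-dominator misses at least `# W / (2 * s)`, that
      -- is `2 * # W / M`, of the children. Those that are `u` itself or stay good number at most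
      -- `q`, hence at most `# W / M`, so at least `# W / M` are killed.
      kill-cover : ∀ u → T (kills (suc k) q F v u) → T (dominates W u) ⊎ T (spoils u)
      kill-cover u ku with T? (dominates W u)
      ... | yes d = inj₁ d
      ... | no ¬d = inj₂ (≤⇒≤ᵇ (+-cancelˡ-≤ (# W) _ _ (begin
        # W + # W                        ≡⟨ cong (# W +_) (+-identityʳ (# W)) ⟨
        2 * # W                          ≤⟨ *-monoʳ-≤ 2 (≮⇒≥ {# missed * (2 * s)} {# W} (¬d ∘ <⇒<ᵇ)) ⟩
        2 * (# missed * (2 * s))         ≤⟨ *-monoʳ-≤ 2 (*-monoˡ-≤ (2 * s) missed≤) ⟩
        2 * ((q + # (killed u)) * (2 * s)) ≡⟨ expand q (# (killed u)) s ⟩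
        M * q + M * # (killed u)         ≤⟨ +-monoˡ-≤ _ Mq≤#W ⟩
        # W + M * # (killed u)           ∎)))
        where
        expand : ∀ a b c → 2 * ((a + b) * (2 * c)) ≡ (4 * c) * a + (4 * c) * b
        expand = solve-∀
        missed alive here-or-alive : Fin n → Bool
        missed w = W w ∧ not (adj G u w)
        alive = children k q (F ∖ u) v
        here-or-alive w = does (u ≟ w) ∨ alive w
        alive<q : # alive < q
        alive<q = ≰⇒> (not-elim ku ∘ ≤⇒≤ᵇ)
        missed≤ : # missed ≤ q + # (killed u)
        missed≤ = begin
          # missed                                       ≤⟨ #-cover missed here-or-alive (killed u) sort ⟩
          # here-or-alive + # (killed u)                 ≤⟨ +-monoˡ-≤ _ (#-cover here-or-alive _ alive (λ w → ∨-elim (does (u ≟ w)))) ⟩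
          (# (λ w → does (u ≟ w)) + # alive) + # (killed u) ≡⟨ cong (λ a → (a + # alive) + # (killed u)) (#-single u) ⟩
          -- The strict inequality `alive<q` leaves room for the one possible missed child `u`
          -- itself.
          suc (# alive) + # (killed u)                   ≤⟨ +-monoˡ-≤ _ alive<q ⟩
          q + # (killed u)                               ∎
          where
          sort : ∀ w → T (missed w) → T (here-or-alive w) ⊎ T (killed u w)
          sort w mw = let (Ww , ¬uw) = ∧-elim {W w} mw in by-cases Ww (not-elim ¬uw) (u ≟ w) (T? _)
            where
            by-cases : T (W w) → ¬ T (adj G u w) → Dec (u ≡ w) → Dec (T (rich k q (F ∖ v ∖ u) w)) →
                       T (here-or-alive w) ⊎ T (killed u w)
            by-cases Ww ¬uw (yes u≡w) _ = inj₁ (∨-introˡ (does (u ≟ w)) (Equivalence.from T-≡ (dec-true (u ≟ w) u≡w)))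
            by-cases Ww ¬uw (no _) (no ¬r)  = inj₂ (∧-intro Ww (not-intro ¬r))
            by-cases Ww ¬uw (no u≢w) (yes r) =
              let (vw , Fw , _) = children-elim {k} {M * q} {F} Ww in
              -- A surviving child is tested after deleting N[v] and then N[u], whereas `alive`
              -- deletes N[u] first; the two deletions commute.
              inj₁ (∨-introʳ (does (u ≟ w))
                (children-intro {k} {q} {F ∖ u} vw (∖-intro {F} Fw ¬uw u≢w)
                  (rich-mono k ≤-refl (∖-swap {F} {v} {u}) r)))

    -- Existence of a rich vertex.

    degree : Fin n → ℕ
    degree v = # (adj G v)

    richDegrees : ℕ → ℕ → ℕ
    richDegrees k q = ∑[ v < n ] (degree v * ⟦ rich k q full v ⟧)

    -- Both sides are compared with the number of pairs `(v, w)` in which `w` is a child of `v`: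
    -- `from-child` bounds it from below through the killers of `w`, `from-parent` from above.
    richDegrees-suc : ∀ k q → 0 < q → richDegrees k (M * q) ≤ richDegrees (suc k) q + n * (M ^ k + q)
    richDegrees-suc k q q>0 = begin
      richDegrees k (M * q)                                                ≤⟨ ∑-mono from-child ⟩
      ∑[ w < n ] (# (λ v → children k q full v w) + M ^ k)                 ≡⟨ ∑-distrib-+ (λ w → # (λ v → children k q full v w)) (λ _ → M ^ k) ⟩
      ∑[ w < n ] # (λ v → children k q full v w) + ∑[ w < n ] (M ^ k)      ≡⟨ cong₂ _+_ (∑-comm (λ w v → ⟦ children k q full v w ⟧))
                                                                                       (∑-const n (M ^ k)) ⟩
      ∑[ v < n ] # (children k q full v) + n * M ^ k                       ≤⟨ +-monoˡ-≤ _ (∑-mono from-parent) ⟩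
      ∑[ v < n ] (degree v * ⟦ rich (suc k) q full v ⟧ + q) + n * M ^ k    ≡⟨ cong (_+ n * M ^ k) (∑-distrib-+ (λ v → degree v * ⟦ rich (suc k) q full v ⟧)
                                                                                                           (λ _ → q)) ⟩
      (richDegrees (suc k) q + ∑[ v < n ] q) + n * M ^ k                   ≡⟨ cong (λ a → (richDegrees (suc k) q + a) + n * M ^ k) (∑-const n q) ⟩
      (richDegrees (suc k) q + n * q) + n * M ^ k                          ≡⟨ regroup (richDegrees (suc k) q) n q (M ^ k) ⟩
      richDegrees (suc k) q + n * (M ^ k + q)                              ∎
      where
      open ≤-Reasoning
      regroup : ∀ a b c d → (a + b * c) + b * d ≡ a + b * (d + c)
      regroup = solve-∀
      from-child : ∀ w → degree w * ⟦ rich k (M * q) full w ⟧ ≤ # (λ v → children k q full v w) + M ^ k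
      from-child w = *-⟦⟧-≤ (rich k (M * q) full w) λ r →
        ≤-trans (#-cover (adj G w) (λ v → children k q full v w) (kills k q full w) split)
                (+-monoʳ-≤ _ (<⇒≤ (few-killers k q full w q>0 r)))
        where
        split : ∀ v → T (adj G w v) → T (children k q full v w) ⊎ T (kills k q full w v)
        split v wv with T? (rich k q (full ∖ v) w)
        ... | yes r = inj₁ (children-intro {k} {q} {full} (subst T (sym G w v) wv) tt r)
        ... | no ¬r = inj₂ (not-intro ¬r)
      from-parent : ∀ v → # (children k q full v) ≤ degree v * ⟦ rich (suc k) q full v ⟧ + q
      from-parent v with q ≤ᵇ # (children k q full v) in eq
      ... | true  = ≤-trans (#-mono (children k q full v) (adj G v) (λ w c → proj₁ (∧-elim c)))
                      (≤-trans (≤-reflexive (≡.sym (*-identityʳ (degree v)))) (m≤m+n _ q))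
      ... | false = ≤-trans (<⇒≤ (≰⇒> λ q≤ → subst T eq (≤⇒≤ᵇ q≤))) (m≤n+m q _)

    -- At depth 0 every vertex is rich. Each further level divides the parameter by `M`, so `k + e`
    -- stays constant along the induction and every level's loss fits under the same
    -- `n * (2 * M ^ (k + e))`.
    ∑-degrees : ∀ k e → ∑[ v < n ] degree v ≤ richDegrees k (M ^ e) + k * (n * (2 * M ^ (k + e)))
    ∑-degrees zero e = ≤-reflexive (≡.trans (sum-cong-≗ (λ v → ≡.sym (*-identityʳ (degree v)))) (≡.sym (+-identityʳ _)))
    ∑-degrees (suc k) e = begin
      ∑[ v < n ] degree v                                                    ≤⟨ ∑-degrees k (suc e) ⟩
      richDegrees k (M * M ^ e) + k * (n * (2 * M ^ (k + suc e)))            ≡⟨ cong (λ a → richDegrees k (M * M ^ e) + k * (n * (2 * M ^ a))) (+-suc k e) ⟩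
      richDegrees k (M * M ^ e) + k * X                                      ≤⟨ +-monoˡ-≤ _ (richDegrees-suc k (M ^ e) (m^n>0 M e)) ⟩
      (richDegrees (suc k) (M ^ e) + n * (M ^ k + M ^ e)) + k * X            ≤⟨ +-monoˡ-≤ (k * X) (+-monoʳ-≤ _ (*-monoʳ-≤ n powers)) ⟩
      (richDegrees (suc k) (M ^ e) + X) + k * X                              ≡⟨ +-assoc (richDegrees (suc k) (M ^ e)) X _ ⟩
      richDegrees (suc k) (M ^ e) + suc k * X                                ∎
      where
      open ≤-Reasoning
      instance
        M≢0 : NonZero M
        M≢0 = >-nonZero M>0
      X : ℕ
      X = n * (2 * M ^ suc (k + e))
      powers : M ^ k + M ^ e ≤ 2 * M ^ suc (k + e)
      powers = +-mono-≤ (^-monoʳ-≤ M (m≤n⇒m≤1+n (m≤m+n k e)))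
                        (≤-trans (^-monoʳ-≤ M (m≤n⇒m≤1+n (m≤n+m e k))) (m≤m+n _ 0))

    rich-root : ∀ k e → k * (n * M ^ (k + e)) < edges G → ∃ λ v → T (rich k (M ^ e) full v)
    rich-root k e many =
      let (v , pos) = ∑-pos {f = λ v → degree v * ⟦ rich k (M ^ e) full v ⟧}
           (+-cancelʳ-< (2 * (k * (n * X))) 0 _ (begin-strict
            2 * (k * (n * X))                                <⟨ *-monoʳ-< 2 many ⟩
            2 * edges G                                      ≡⟨ handshake G ⟨
            ∑[ v < n ] degree v                              ≤⟨ ∑-degrees k e ⟩
            richDegrees k (M ^ e) + k * (n * (2 * X))        ≡⟨ cong (richDegrees k (M ^ e) +_) (regroup k n X) ⟩
            richDegrees k (M ^ e) + 2 * (k * (n * X))        ∎))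
      in v , ⟦⟧-pos (factor (degree v) pos)
      where
      open ≤-Reasoning
      X : ℕ
      X = M ^ (k + e)
      regroup : ∀ a b c → a * (b * (2 * c)) ≡ 2 * (a * (b * c))
      regroup = solve-∀
      factor : ∀ a {b} → 0 < a * b → 0 < b
      factor a {zero}  h = subst (0 <_) (*-zeroʳ a) h
      factor a {suc b} h = z<s

    -- Greedy induced embedding along an order.

    module Embed {t} (H : Graph t) where

      -- Every placed vertex keeps a set `F a` of its own, cleared of the closed neighbourhoods of
      -- all other placed vertices but not of its own. A neighbour of `φ a` chosen in `F a`
      -- therefore has no other neighbour in the copy.
      record Embedding (xs : List (Fin t)) (k q : ℕ) : Set where
        field
          φ      : Fin (length xs) → Fin n
          F      : Fin (length xs) → Fin n → Bool
          φ-rich : ∀ a → T (rich k q (F a) (φ a))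
          avoids : ∀ {a b x} → a ≢ b → T (F a x) → ¬ T (adj G (φ b) x) × φ b ≢ x
          φ-inj  : ∀ a b → φ a ≡ φ b → a ≡ b
          φ-adj  : ∀ a b → adj G (φ a) (φ b) ≡ adj H (lookup xs a) (lookup xs b)

      singleton : ∀ {k q v} w → T (rich k q full v) → Embedding (w ∷ []) k q
      singleton {v = v} w r = record
        { φ = λ _ → v ; F = λ _ → full ; φ-rich = λ _ → r
        ; avoids = λ { {zero} {zero} 0≢0 _ → ⊥-elim (0≢0 refl) }
        ; φ-inj = λ { zero zero _ → refl }
        ; φ-adj = λ { zero zero → ≡.trans (irrefl G v) (≡.sym (irrefl H w)) }
        }

      add-leaf : ∀ {xs k q} w (p : Fin (length xs)) → (∀ a → adj H w (lookup xs a) ≡ does (a ≟ p)) →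
                 0 < q → length xs * M ^ suc k < M * q →
                 Embedding xs (suc k) (M * q) → Embedding (w ∷ xs) k q
      add-leaf {xs} {k} {q} w p w-adj q>0 room E =
        -- `C` consists of children of `φ p` that kill no placed vertex; `room` says that the
        -- killers cannot exhaust the children.
        let (C , C-ok , C-large) = #-common W (λ a y → rich (suc k) q (F a ∖ y) (φ a))
            (y , Cy) = #-∃ {p = C} (C-nonempty C C-large)
            (Wy , y-rich) = C-ok y Cy
            (py , Fy , r) = children-elim {k} {M * q} {F p} {φ p} {y} Wy
        in Add.result y py Fy r y-rich
        where
        open Embedding E
        open ≤-Reasoning
        instance
          M≢0 : NonZero M
          M≢0 = >-nonZero M>0
        W : Fin n → Bool
        W = children k (M * q) (F p) (φ p)
        lost : Fin (length xs) → ℕ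
        lost a = # (λ y → W y ∧ not (rich (suc k) q (F a ∖ y) (φ a)))
        lost≤ : ∀ a → lost a ≤ M ^ suc k
        lost≤ a = ≤-trans (#-mono _ (kills (suc k) q (F a) (φ a)) (λ y h → proj₂ (∧-elim {W y} h)))
                          (<⇒≤ (few-killers (suc k) q (F a) (φ a) q>0 (φ-rich a)))
        C-nonempty : ∀ C → # W ≤ # C + sum lost → 0 < # C
        C-nonempty C C-large = +-cancelʳ-< (sum lost) 0 (# C) (begin-strict
          sum lost                                ≤⟨ ∑-mono lost≤ ⟩
          ∑[ a < length xs ] (M ^ suc k)          ≡⟨ ∑-const (length xs) (M ^ suc k) ⟩
          length xs * M ^ suc k                   <⟨ room ⟩
          M * q                                   ≤⟨ ≤ᵇ⇒≤ (M * q) (# W) (φ-rich p) ⟩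
          # W                                     ≤⟨ C-large ⟩
          # C + sum lost                          ∎)

        module Add (y : Fin n) (py : T (adj G (φ p) y)) (Fy : T (F p y))
                   (r : T (rich k (M * q) (F p ∖ φ p) y))
                   (y-rich : ∀ a → T (rich (suc k) q (F a ∖ y) (φ a))) where

          φ′ : Fin (suc (length xs)) → Fin n
          φ′ zero    = y
          φ′ (suc a) = φ a

          F′ : Fin (suc (length xs)) → Fin n → Bool
          -- This is the set in which `y`, as a child of `φ p`, is known to be rich; it also avoids
          -- every earlier image.
          F′ zero    = F p ∖ φ p
          F′ (suc a) = F a ∖ y

          y≢φ : ∀ b → φ b ≢ y
          y≢φ b e with p ≟ b
          ... | yes refl = subst T (≡.trans (cong (adj G (φ p)) (≡.sym e)) (irrefl G (φ p))) py
          ... | no p≢b   = proj₂ (avoids p≢b Fy) e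

          avoids′ : ∀ {a b x} → a ≢ b → T (F′ a x) → ¬ T (adj G (φ′ b) x) × φ′ b ≢ x
          avoids′ {zero}  {zero}  a≢b h = ⊥-elim (a≢b refl)
          avoids′ {zero}  {suc b} a≢b h with p ≟ b
          ... | yes refl = proj₂ (∖-elim {F p} h)
          ... | no p≢b   = avoids p≢b (proj₁ (∖-elim {F p} h))
          avoids′ {suc a} {zero}  a≢b h = proj₂ (∖-elim {F a} h)
          avoids′ {suc a} {suc b} a≢b h = avoids (a≢b ∘ cong suc) (proj₁ (∖-elim {F a} h))

          y-adj : ∀ b → adj G (φ b) y ≡ does (b ≟ p)
          y-adj b with b ≟ p
          ... | yes refl = Equivalence.to T-≡ py
          ... | no b≢p   = ¬T⇒false (proj₁ (avoids (b≢p ∘ ≡.sym) Fy))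

          φ-inj′ : ∀ a b → φ′ a ≡ φ′ b → a ≡ b
          φ-inj′ zero    zero    e = refl
          φ-inj′ zero    (suc b) e = ⊥-elim (y≢φ b (≡.sym e))
          φ-inj′ (suc a) zero    e = ⊥-elim (y≢φ a e)
          φ-inj′ (suc a) (suc b) e = cong suc (φ-inj a b e)

          φ-adj′ : ∀ a b → adj G (φ′ a) (φ′ b) ≡ adj H (lookup (w ∷ xs) a) (lookup (w ∷ xs) b)
          φ-adj′ zero    zero    = ≡.trans (irrefl G y) (≡.sym (irrefl H w))
          φ-adj′ zero    (suc b) = ≡.trans (sym G y (φ b)) (≡.trans (y-adj b) (≡.sym (w-adj b)))
          φ-adj′ (suc a) zero    = ≡.trans (y-adj a) (≡.trans (≡.sym (w-adj a)) (sym H w (lookup xs a)))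
          φ-adj′ (suc a) (suc b) = φ-adj a b

          φ-rich′ : ∀ a → T (rich k q (F′ a) (φ′ a))
          -- The new vertex has lost a level of depth but kept the parameter `M * q`; the old ones
          -- kept their depth but fell to parameter `q`. Both are weakened to the common pair `k`,
          -- `q`.
          φ-rich′ zero    = rich-mono k (m≤n*m q M) id r
          φ-rich′ (suc a) = rich-lower k (y-rich a)

          result : Embedding (w ∷ xs) k q
          result = record
            { φ = φ′ ; F = F′ ; φ-rich = φ-rich′ ; avoids = avoids′ ; φ-inj = φ-inj′ ; φ-adj = φ-adj′ }

      -- Each vertex of the list spends one level of depth and one factor `M`; `k` is the depth left
      -- for later leaves. The surplus `M ^ e` exceeds the number of placed vertices, each of which
      -- forbids at most `M ^ suc k` of the at least `M ^ suc (k + e)` candidates.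
      embed : ∀ {xs} → Order H xs → ∀ k e {v} → length xs < M ^ e →
              T (rich (length xs + k) (M ^ (length xs + k + e)) full v) → Embedding xs k (M ^ (k + e))
      embed (root w) k e small r =
        -- One level and one factor `M` are given up for the root as well, so that the budget is
        -- counted by the length of the list.
        singleton w (rich-mono k (^-monoʳ-≤ M {{>-nonZero M>0}} (n≤1+n (k + e))) id (rich-lower k r))
      embed {w ∷ xs} (leaf w p o w-adj) k e {v} small r =
        add-leaf w p w-adj (m^n>0 M (k + e)) room
          (embed o (suc k) e {v} (<-trans ≤-refl small)
            (subst (λ m → T (rich m (M ^ (m + e)) full v)) (≡.sym (+-suc (length xs) k)) r))
        where
        open ≤-Reasoning
        instance
          M≢0 : NonZero M
          M≢0 = >-nonZero M>0
        room : length xs * M ^ suc k < M * M ^ (k + e)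
        room = begin-strict
          length xs * M ^ suc k  <⟨ *-monoˡ-< (M ^ suc k) {{m^n≢0 M (suc k)}} (<-trans ≤-refl small) ⟩
          M ^ e * M ^ suc k      ≡⟨ *-comm (M ^ e) _ ⟩
          M ^ suc k * M ^ e      ≡⟨ ^-distribˡ-+-* M (suc k) e ⟨
          M ^ (suc k + e)        ∎

-- Leaf orders of trees.

data Growing {t} (H : Graph t) : List (Fin t) → Set where
  root : ∀ v → Growing H (v ∷ [])
  grow : ∀ {xs} w (p : Fin (length xs)) → w ∉ xs → adj H w (lookup xs p) ≡ true →
         Growing H xs → Growing H (w ∷ xs)

module _ {t} (H : Graph t) where

  back-degree : Fin t → List (Fin t) → ℕ
  back-degree w xs = # (λ a → adj H w (lookup xs a))

  -- For a list without repetitions this is twice the number of edges induced on it.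
  degree-sum : List (Fin t) → ℕ
  degree-sum xs = ∑[ a < length xs ] back-degree (lookup xs a) xs

  degree-sum-∷ : ∀ w xs → degree-sum (w ∷ xs) ≡ 2 * back-degree w xs + degree-sum xs
  degree-sum-∷ w xs = begin
    (⟦ adj H w w ⟧ + d) + ∑[ a < length xs ] (⟦ adj H (lookup xs a) w ⟧ + back-degree (lookup xs a) xs)
      ≡⟨ cong₂ (λ b c → (⟦ b ⟧ + d) + c) (irrefl H w)
            (∑-distrib-+ (λ a → ⟦ adj H (lookup xs a) w ⟧) (λ a → back-degree (lookup xs a) xs)) ⟩
    d + (# (λ a → adj H (lookup xs a) w) + degree-sum xs)
      ≡⟨ cong (λ c → d + (c + degree-sum xs)) (sum-cong-≗ λ a → cong ⟦_⟧ (sym H (lookup xs a) w)) ⟩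
    d + (d + degree-sum xs)
      ≡⟨ regroup d (degree-sum xs) ⟩
    2 * d + degree-sum xs ∎
    where
    open ≡.≡-Reasoning
    d : ℕ
    d = back-degree w xs
    regroup : ∀ a b → a + (a + b) ≡ 2 * a + b
    regroup = solve-∀

  back-degree-pos : ∀ {w} xs p → adj H w (lookup xs p) ≡ true → 1 ≤ back-degree w xs
  back-degree-pos {w} xs p e = #-pos {p = λ a → adj H w (lookup xs a)} {p} (Equivalence.from T-≡ e)

  -- Every vertex after the first brings at least one edge, so `m` vertices span at least `m - 1`
  -- edges; the bound is doubled and written without subtraction.
  growing-lower : ∀ {xs} → Growing H xs → 2 * length xs ≤ 2 + degree-sum xs
  growing-lower (root v) = m≤m+n 2 _
  growing-lower {w ∷ xs} (grow w p _ e g) = begin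
    2 * suc (length xs)                              ≡⟨ *-suc 2 (length xs) ⟩
    2 + 2 * length xs                                ≤⟨ +-monoʳ-≤ 2 (growing-lower g) ⟩
    2 + (2 + degree-sum xs)                          ≤⟨ +-monoʳ-≤ 2 (+-monoˡ-≤ _ (*-monoʳ-≤ 2 (back-degree-pos xs p e))) ⟩
    2 + (2 * back-degree w xs + degree-sum xs)       ≡⟨ cong (2 +_) (degree-sum-∷ w xs) ⟨
    2 + degree-sum (w ∷ xs)                          ∎
    where open ≤-Reasoning

  -- Each vertex after the first has at least one earlier neighbour, so a tree, having only t - 1 edges,
  -- leaves room for exactly one.
  growing⇒order : ∀ {xs} → Growing H xs → 2 + degree-sum xs ≤ 2 * length xs → Order H xs
  growing⇒order (root v) _ = root v
  growing⇒order {w ∷ xs} (grow w p w∉ e g) few = leaf w p (growing⇒order g few′) only-p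
    where
    open ≤-Reasoning
    d : ℕ
    d = back-degree w xs
    few₁ : 2 * d + degree-sum xs ≤ 2 * length xs
    few₁ = +-cancelˡ-≤ 2 _ _ (begin
      2 + (2 * d + degree-sum xs)  ≡⟨ cong (2 +_) (degree-sum-∷ w xs) ⟨
      2 + degree-sum (w ∷ xs)      ≤⟨ few ⟩
      2 * suc (length xs)          ≡⟨ *-suc 2 (length xs) ⟩
      2 + 2 * length xs            ∎)
    few′ : 2 + degree-sum xs ≤ 2 * length xs
    few′ = ≤-trans (+-monoˡ-≤ (degree-sum xs) (*-monoʳ-≤ 2 (back-degree-pos xs p e))) few₁
    d≤1 : d ≤ 1
    d≤1 = *-cancelˡ-≤ 2 (+-cancelʳ-≤ (degree-sum xs) _ _ (≤-trans few₁ (growing-lower g)))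
    only-p : ∀ a → adj H w (lookup xs a) ≡ does (a ≟ p)
    only-p a with a ≟ p
    ... | yes refl = e
    ... | no a≢p   = ¬T⇒false λ y → a≢p
      (#-unique {p = λ b → adj H w (lookup xs b)} d≤1 y (Equivalence.from T-≡ e))

  growing-injective : ∀ {xs} → Growing H xs → ∀ a b → lookup xs a ≡ lookup xs b → a ≡ b
  growing-injective (root v) zero zero _ = refl
  growing-injective (grow w p w∉ e g) zero    zero    _  = refl
  growing-injective (grow {xs} w p w∉ e g) zero    (suc b) eq =
    ⊥-elim (w∉ (subst (_∈ xs) (≡.sym eq) (∈-lookup b)))
  growing-injective (grow {xs} w p w∉ e g) (suc a) zero    eq =
    ⊥-elim (w∉ (subst (_∈ xs) eq (∈-lookup a)))
  growing-injective (grow w p w∉ e g) (suc a) (suc b) eq = cong suc (growing-injective g a b eq)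

  -- Walk along the path and prepend each vertex not yet listed; its predecessor on the path is
  -- listed already and serves as its earlier neighbour.
  reach-grow : ∀ {xs i k} → Growing H xs → i ∈ xs → Reach H i k →
               ∃ λ ys → Growing H ys × xs ⊆ ys × k ∈ ys
  reach-grow {xs} g i∈ here = xs , g , id , i∈
  reach-grow {xs} {i} g i∈ (step {j = j} ij jk) with any? (j ≟_) xs
  ... | yes j∈ = reach-grow g j∈ jk
  ... | no j∉  =
    let ji = ≡.trans (sym H j _) (≡.trans (cong (λ x → adj H x j) (≡.sym (lookup-index i∈))) ij)
        (ys , g′ , ⊆ys , k∈) = reach-grow (grow j (index i∈) j∉ ji g) (here refl) jk
    in ys , g′ , ⊆ys ∘ there , k∈

  connected-grow : Connected H → ∀ {xs} → Growing H xs → ∀ zs →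
                   ∃ λ ys → Growing H ys × xs ⊆ ys × zs ⊆ ys
  connected-grow conn {xs} g []       = xs , g , id , λ ()
  connected-grow conn g (z ∷ zs) =
    let (ys , g₁ , xs⊆ , zs⊆) = connected-grow conn g zs
        (y , y∈) = member g₁
        (ys′ , g₂ , ys⊆ , z∈) = reach-grow g₁ y∈ (conn y z)
    in ys′ , g₂ , ys⊆ ∘ xs⊆ , λ { (here refl) → z∈ ; (there m) → ys⊆ (zs⊆ m) }
    where
    member : ∀ {ys} → Growing H ys → ∃ λ y → y ∈ ys
    member (root v)          = v , here refl
    member (grow w _ _ _ _)  = w , here refl

  tree-order : IsTree H → ∃ λ xs → Order H xs × (∀ i → i ∈ xs) × length xs ≡ t
  tree-order (t≥1 , conn , few) =
    let (xs , g , _ , all⊆) = connected-grow conn (root (first t≥1)) (allFin t)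
    in xs , order xs g (λ i → all⊆ (∈-allFin i))
    where
    first : ∀ {m} → 1 ≤ m → Fin m
    first (s≤s _) = zero
    order : ∀ xs → Growing H xs → (∀ i → i ∈ xs) →
            Order H xs × (∀ i → i ∈ xs) × length xs ≡ t
    order xs g all∈ = growing⇒order g (≤-reflexive few′) , all∈ , length≡t
      where
      open ≡.≡-Reasoning
      -- The list enumerates all vertices without repetition. Reindexing by `π` turns
      -- `degree-sum xs` into the full degree sum, to which the edge count of a tree applies.
      π : Permutation (length xs) t
      π = permutation (lookup xs) (λ i → index (all∈ i))
            (λ i → ≡.sym (lookup-index (all∈ i)))
            (λ a → growing-injective g _ a (≡.sym (lookup-index (all∈ (lookup xs a)))))
      length≡t : length xs ≡ t
      length≡t = ↔⇒≡ π
      few′ : 2 + degree-sum xs ≡ 2 * length xs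
      few′ = begin
        2 + degree-sum xs                                        ≡⟨ cong (2 +_) (sum-cong-≗ λ a →
                                                                      sum-permute (λ j → ⟦ adj H (lookup xs a) j ⟧) π) ⟨
        2 + ∑[ a < length xs ] # (adj H (lookup xs a))           ≡⟨ cong (2 +_) (sum-permute (λ i → # (adj H i)) π) ⟨
        2 + ∑[ i < t ] # (adj H i)                               ≡⟨ cong (2 +_) (handshake H) ⟩
        2 + 2 * edges H                                          ≡⟨ *-suc 2 (edges H) ⟨
        2 * suc (edges H)                                        ≡⟨ cong (λ m → 2 * suc m) few ⟩
        2 * suc (t ∸ 1)                                          ≡⟨ cong (2 *_) (m+[n∸m]≡n t≥1) ⟩
        2 * t                                                    ≡⟨ cong (2 *_) length≡t ⟨
        2 * length xs                                            ∎

-- Choice of the constants.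

theorem1p3 : Σ ℕ λ C → 0 < C ×
    ((t : ℕ) → Σ ℕ λ s₀ → (T : Graph t) → IsTree T →
    (s : ℕ) → s₀ ≤ s → (n : ℕ) → 1 ≤ n → (G : Graph n) →
    ¬ ContainsKss s G → ¬ ContainsInduced T G →
    edges G ≤ s ^ (C * t) * n)
-- The loss in `rich-root` is `t * (n * M ^ (3 * t))`, at most `M ^ (4 * t) * n`. For `s` at least
-- 4, `M = 4 * s` is at most `s ^ 2`, whence the exponent `8 * t`.
theorem1p3 = 8 , z<s , λ t → 4 , λ H tree s 4≤s n _ G Kss-free H-free →
  ≮⇒≥ λ many → H-free (induced-copy H tree 4≤s G Kss-free many)
  where
  induced-copy : ∀ {t} (H : Graph t) → IsTree H → ∀ {s} → 4 ≤ s → ∀ {n} (G : Graph n) →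
                 ¬ ContainsKss s G → s ^ (8 * t) * n < edges G → ContainsInduced H G
  induced-copy {t} H tree {s} 4≤s {n} G Kss-free many =
    -- Placing `t` vertices takes depth `t` and parameter `M ^ (t + t)`: a factor `M` for each
    -- vertex, and the surplus `M ^ t`, which exceeds `t`.
    let (v , v-rich) = rich-root t (t + t) (≤-<-trans bound many)
        (xs , order , all∈ , length≡t) = tree-order H tree
        E = embed order 0 t {v} (subst (_< M ^ t) (≡.sym length≡t) (t<M^t t))
              (subst (λ m → T (rich m (M ^ (m + t)) full v))
                (≡.trans (≡.sym length≡t) (≡.sym (+-identityʳ _))) v-rich)
        open Embedding E
        pos = λ i → index (all∈ i)
        lookup-pos = λ i → lookup-index (all∈ i)
    in (φ ∘ pos)
     , (λ {i} {j} e → ≡.trans (lookup-pos i)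
          (≡.trans (cong (lookup xs) (φ-inj (pos i) (pos j) e)) (≡.sym (lookup-pos j))))
     , (λ i j → ≡.trans (φ-adj (pos i) (pos j)) (≡.sym (cong₂ (adj H) (lookup-pos i) (lookup-pos j))))
    where
    s>0 : 0 < s
    s>0 = ≤-trans (s≤s z≤n) 4≤s
    open Rich G
    open Biclique-free s>0 Kss-free
    open Embed H
    open ≤-Reasoning
    instance
      M≢0 : NonZero M
      M≢0 = >-nonZero M>0
    2≤M : 2 ≤ M
    2≤M = ≤-trans (s≤s (s≤s z≤n)) (≤-trans 4≤s (m≤n*m s 4))
    t<M^t : ∀ m → m < M ^ m
    t<M^t zero    = s≤s z≤n
    t<M^t (suc m) = begin-strict
      suc m          ≤⟨ t<M^t m ⟩
      M ^ m          <⟨ ^-monoʳ-< M 2≤M (n<1+n m) ⟩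
      M ^ suc m      ∎
    bound : t * (n * M ^ (t + (t + t))) ≤ s ^ (8 * t) * n
    bound = begin
      t * (n * M ^ (t + (t + t)))            ≤⟨ *-monoˡ-≤ _ (<⇒≤ (t<M^t t)) ⟩
      M ^ t * (n * M ^ (t + (t + t)))        ≡⟨ swap (M ^ t) n _ ⟩
      (M ^ t * M ^ (t + (t + t))) * n        ≡⟨ cong (_* n) (^-distribˡ-+-* M t (t + (t + t))) ⟨
      M ^ (t + (t + (t + t))) * n            ≤⟨ *-monoˡ-≤ n (^-monoˡ-≤ (t + (t + (t + t))) (*-monoˡ-≤ s 4≤s)) ⟩
      (s * s) ^ (t + (t + (t + t))) * n      ≡⟨ cong (λ a → (s * a) ^ (t + (t + (t + t))) * n) (*-identityʳ s) ⟨
      (s ^ 2) ^ (t + (t + (t + t))) * n      ≡⟨ cong (_* n) (^-*-assoc s 2 (t + (t + (t + t)))) ⟩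
      s ^ (2 * (t + (t + (t + t)))) * n      ≡⟨ cong (λ a → s ^ a * n) (eight t) ⟩
      s ^ (8 * t) * n                        ∎
      where
      swap : ∀ a b c → a * (b * c) ≡ (a * c) * b
      swap = solve-∀
      eight : ∀ a → 2 * (a + (a + (a + a))) ≡ 8 * a
      eight = solve-∀
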